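{- There exist a real number $\epsilon>0$ and a set $N$ of positive integers of positive asymptotic density (i.e. $\liminf_{x\to\infty}|N\cap[x]|/x>0$) such that for every $n\in N$, $$\mathrm{ex}(n,C_4)\le \frac12 n^{3/2}+\left(\frac14-\epsilon\right)n.$$
   Context: $\mathrm{ex}(n,C_4)$ denotes the maximum number of edges in an $n$-vertex simple graph containing no cycle of length four as a subgraph. -}

module Defs where

open import Data.Nat as ℕ using (ℕ; zero; suc; _<ᵇ_; _^_)
open import Data.Bool using (Bool; true; false; if_then_else_; _∧_)
open import Data.Fin using (Fin; toℕ)
open import Data.List using (List; map; upTo; allFin)
open import Data.Nat.ListAction using (sum)
open import Data.Integer as ℤ using (ℤ; +_; 0ℤ)
open import Data.Product using (∃-syntax; _×_)
open import Data.Sum using (_⊎_)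
open import Relation.Nullary using (¬_)
open import Relation.Binary.PropositionalEquality using (_≡_; _≢_)

record SimpleGraph (n : ℕ) : Set where
  field
    adj   : Fin n → Fin n → Bool
    sym   : ∀ i j → adj i j ≡ adj j i
    irrefl : ∀ i → adj i i ≡ false
open SimpleGraph public

edgeCount : ∀ {n} → SimpleGraph n → ℕ
edgeCount {n} G =
  sum (map (λ i → sum (map (λ j → if (toℕ i <ᵇ toℕ j) ∧ adj G i j then 1 else 0)
                           (allFin n)))
           (allFin n))

ContainsC4 : ∀ {n} → SimpleGraph n → Set
ContainsC4 {n} G =
  ∃[ a ] ∃[ b ] ∃[ c ] ∃[ d ]
    ((a ≢ b) × (a ≢ c) × (a ≢ d) × (b ≢ c) × (b ≢ d) × (c ≢ d)) ×
    (adj G a b ≡ true) × (adj G b c ≡ true) × (adj G c d ≡ true) × (adj G d a ≡ true)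

C4Free : ∀ {n} → SimpleGraph n → Set
C4Free G = ¬ ContainsC4 G

-- BoundHolds p q n E  :⇔  E ≤ (1/2) n^{3/2} + (1/4 - p/q) n   (for q > 0),
-- stated without reals: multiplying by 4q it reads A ≤ 2q·n^{3/2} with
-- A = 4qE - (q - 4p)n ∈ ℤ; since the right side is ≥ 0 this is
-- equivalent to  A ≤ 0  or  A² ≤ 4q²n³.
BoundHolds : ℕ → ℕ → ℕ → ℕ → Set
BoundHolds p q n E =
  let A = (+ (4 ℕ.* q ℕ.* E)) ℤ.- ((+ q ℤ.- + (4 ℕ.* p)) ℤ.* + n)
  in (A ℤ.≤ 0ℤ) ⊎ (A ℤ.* A ℤ.≤ + (4 ℕ.* q ℕ.* q ℕ.* n ^ 3))

-- ex(n, C4) ≤ (1/2) n^{3/2} + (1/4 - p/q) n : every C4-free simple graph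
-- on n vertices has at most that many edges (ex is the maximum over them).
ExC4Bound : ℕ → ℕ → ℕ → Set
ExC4Bound p q n = (G : SimpleGraph n) → C4Free G → BoundHolds p q n (edgeCount G)

countUpTo : (ℕ → Bool) → ℕ → ℕ
countUpTo N x = sum (map (λ m → if N (suc m) then 1 else 0) (upTo x))

-- positive asymptotic (lower) density: liminf |N ∩ [x]|/x > 0, i.e.
-- there is a rational δ = a/b > 0 and a threshold M with |N∩[x]| ≥ δx for x ≥ M.
PositiveLowerDensity : (ℕ → Bool) → Set
PositiveLowerDensity N =
  ∃[ a ] ∃[ b ] ∃[ M ] (0 ℕ.< a) × (0 ℕ.< b) ×
    (∀ x → M ℕ.≤ x → a ℕ.* x ℕ.≤ b ℕ.* countUpTo N x)

{-# OPTIONS --safe #-}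
-- Let n = k² + r with 0 ≤ 40 (r + 1) ≤ k, let G be C₄-free with adjacency
-- matrix A and degrees d, and put y = 2d − (2k + 1).  The entries of y are odd,
-- so Σ|y| ≥ n.  If G had more than ½ n^{3/2} + (¼ − 1/160) n edges then Σ y > −n/40,
-- and counting paths of length two would give Σ y² = O(δ k n) and Σ f = O(δ k n)
-- with small δ, where f(v) is the number of u ≠ v having no common neighbour with v.
-- By C₄-freeness A² = J − I + D − M with M ≥ 0 the matrix of these pairs; as
-- M1 = f this makes y nearly an eigenvector of A with eigenvalue −k.  Evaluating
-- A²y once through this and once through J − I + D − M shows that y is close, in
-- L¹ norm, to the constant vector (Σ y)/n, which is O(δ): hence Σ|y| = O(δ n) < n,
-- a contradiction.
module Submission where

open import Defs hiding (sym)
import Data.Integer.Properties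
open import Algebra.Properties.Semiring.Sum Data.Integer.Properties.+-*-semiring
  using (sum; ∑-distrib-+; ∑-comm; sum-cong-≗; *-distribˡ-sum)
open import Data.Bool using (Bool; true; false; if_then_else_; _∧_; T)
open import Data.Empty using (⊥)
open import Data.Fin using (Fin; zero; suc; toℕ)
import Data.Fin.Properties as Fin
open import Data.Integer
  using (ℤ; +_; -_; 0ℤ; 1ℤ; _+_; _*_; _-_; _≤_; +≤+; -≤+; ∣_∣; -[1+_]; positive)
import Data.Integer as ℤ
open import Data.Integer.Properties
open import Data.Integer.Tactic.RingSolver using (solve-∀)
open import Data.List using (map; allFin; tabulate; upTo; _++_; _∷ʳ_; []; _∷_)
open import Data.List.Properties using (map-tabulate; upTo-∷ʳ; map-++)
open import Data.Nat using (ℕ; zero; suc; _<_; z≤n; s≤s; _<ᵇ_; _≤ᵇ_)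
import Data.Nat as ℕ
import Data.Nat.Properties as ℕ
import Data.Nat.ListAction as List
open import Data.Nat.ListAction.Properties using (sum-++)
import Data.Nat.Tactic.RingSolver as ℕRing
open import Data.Product using (∃-syntax; _×_; _,_; proj₁; proj₂)
open import Data.Sum using (_⊎_; inj₁; inj₂)
open import Function using (_∘_; id)
open import Relation.Nullary using (yes; no; contradiction)
open import Relation.Nullary.Decidable using (⌊_⌋)
open import Relation.Binary.PropositionalEquality
  using (_≡_; _≢_; refl; sym; trans; cong; cong₂; subst; module ≡-Reasoning)

-- Integer inequalities from nonnegative differences.

infixr 6 _⊕_
infixr 7 _⊗_

_⊕_ : ∀ {i j} → 0ℤ ≤ i → 0ℤ ≤ j → 0ℤ ≤ i + j
_⊕_ = +-mono-≤

_⊗_ : ∀ {i j} → 0ℤ ≤ i → 0ℤ ≤ j → 0ℤ ≤ i * j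
_⊗_ {+ m} {+ n} _ _ = subst (0ℤ ≤_) (pos-* m n) (+≤+ z≤n)

0≤+ : ∀ n → 0ℤ ≤ + n
0≤+ n = +≤+ z≤n

-- The pattern of every polynomial inequality below: the ring solver rewrites the difference of the
-- two sides as an explicit expression `c`, and `_⊕_` and `_⊗_` assemble the nonnegativity of `c`
-- term by term.
≤-from-gap : ∀ {i j c} → j - i ≡ c → 0ℤ ≤ c → i ≤ j
≤-from-gap eq 0≤c = 0≤i-j⇒j≤i (subst (0ℤ ≤_) (sym eq) 0≤c)

gap : ∀ {i j} → i ≤ j → 0ℤ ≤ j - i
gap = i≤j⇒0≤j-i

-- Finite sums and indicators.

-- Opaque, so that ∑ f ≟ ∑ g is solved by unifying f with g.
opaque
  ∑ : ∀ {n} → (Fin n → ℤ) → ℤ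
  ∑ = sum

  ∑-zero : (f : Fin 0 → ℤ) → ∑ f ≡ 0ℤ
  ∑-zero f = refl

  ∑-suc : ∀ {n} (f : Fin (suc n) → ℤ) → ∑ f ≡ f zero + ∑ (λ i → f (suc i))
  ∑-suc f = refl

  ∑-cong : ∀ {n} {f g : Fin n → ℤ} → (∀ i → f i ≡ g i) → ∑ f ≡ ∑ g
  ∑-cong = sum-cong-≗

  ∑-+ : ∀ {n} (f g : Fin n → ℤ) → ∑ (λ i → f i + g i) ≡ ∑ f + ∑ g
  ∑-+ = ∑-distrib-+

  ∑-* : ∀ {n} c (f : Fin n → ℤ) → ∑ (λ i → c * f i) ≡ c * ∑ f
  ∑-* c f = sym (*-distribˡ-sum c f)

  ∑-swap : ∀ {m n} (f : Fin m → Fin n → ℤ) → ∑ (λ i → ∑ (λ j → f i j)) ≡ ∑ (λ j → ∑ (λ i → f i j))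
  ∑-swap = ∑-comm

  ∑-const : ∀ n c → ∑ {n} (λ _ → c) ≡ c * + n
  ∑-const zero    c = sym (*-zeroʳ c)
  ∑-const (suc n) c = trans (cong (λ s → c + s) (∑-const n c)) (sym (*-suc c (+ n)))

  ∑-mono : ∀ {n} {f g : Fin n → ℤ} → (∀ i → f i ≤ g i) → ∑ f ≤ ∑ g
  ∑-mono {zero}  f≤g = ≤-refl
  ∑-mono {suc n} f≤g = +-mono-≤ (f≤g zero) (∑-mono (f≤g ∘ suc))

∑-nonneg : ∀ {n} {f : Fin n → ℤ} → (∀ i → 0ℤ ≤ f i) → 0ℤ ≤ ∑ f
∑-nonneg {n} 0≤f = ≤-trans (≤-reflexive (sym (∑-const n 0ℤ))) (∑-mono 0≤f)

-- The combinators below evaluate a sum by following the shape of its summand.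
infixr 6 _+∑_
infixr 7 _*∑_

_+∑_ : ∀ {n s t} {f g : Fin n → ℤ} → ∑ f ≡ s → ∑ g ≡ t → ∑ (λ i → f i + g i) ≡ s + t
_+∑_ {f = f} {g} p q = trans (∑-+ f g) (cong₂ _+_ p q)

_*∑_ : ∀ {n s} {f : Fin n → ℤ} c → ∑ f ≡ s → ∑ (λ i → c * f i) ≡ c * s
_*∑_ {f = f} c p = trans (∑-* c f) (cong (c *_) p)

δ : ∀ {n} → Fin n → Fin n → ℤ
δ i j = if ⌊ i Fin.≟ j ⌋ then 1ℤ else 0ℤ

δ-suc : ∀ {n} (i j : Fin n) → δ (suc i) (suc j) ≡ δ i j
δ-suc i j with i Fin.≟ j
... | yes _ = refl
... | no  _ = refl

∑-δ : ∀ {n} (i : Fin n) (f : Fin n → ℤ) → ∑ (λ j → δ i j * f j) ≡ f i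
∑-δ {suc n} zero f = begin
  ∑ (λ j → δ zero j * f j)               ≡⟨ ∑-suc _ ⟩
  1ℤ * f zero + ∑ (λ j → 0ℤ * f (suc j)) ≡⟨ cong₂ _+_ (*-identityˡ (f zero)) (∑-* 0ℤ (f ∘ suc)) ⟩
  f zero + 0ℤ * ∑ (f ∘ suc)              ≡⟨ cong (λ s → f zero + s) (*-zeroˡ (∑ (f ∘ suc))) ⟩
  f zero + 0ℤ                            ≡⟨ +-identityʳ (f zero) ⟩
  f zero                                 ∎
  where open ≡-Reasoning
∑-δ {suc n} (suc i) f = begin
  ∑ (λ j → δ (suc i) j * f j)
    ≡⟨ ∑-suc _ ⟩
  0ℤ * f zero + ∑ (λ j → δ (suc i) (suc j) * f (suc j))
    ≡⟨ cong₂ _+_ (*-zeroˡ (f zero)) (∑-cong (λ j → cong (_* f (suc j)) (δ-suc i j))) ⟩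
  0ℤ + ∑ (λ j → δ i j * f (suc j))
    ≡⟨ +-identityˡ _ ⟩
  ∑ (λ j → δ i j * f (suc j))
    ≡⟨ ∑-δ i (f ∘ suc) ⟩
  f (suc i) ∎
  where open ≡-Reasoning

[_] : Bool → ℤ
[ b ] = if b then 1ℤ else 0ℤ

0≤[_] : ∀ b → 0ℤ ≤ [ b ]
0≤[ true  ] = 0≤+ 1
0≤[ false ] = ≤-refl

∑[]≡0 : ∀ {n} (p : Fin n → Bool) → (∀ i → p i ≡ false) → ∑ (λ i → [ p i ]) ≡ 0ℤ
∑[]≡0 {n} p none = trans (∑-cong (λ i → cong [_] (none i))) (∑-const n 0ℤ)

∑[]≤1 : ∀ {n} (p : Fin n → Bool) → (∀ i j → p i ≡ true → p j ≡ true → i ≡ j) →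
        ∑ (λ i → [ p i ]) ≤ 1ℤ
∑[]≤1 {zero}  p unique = subst (_≤ 1ℤ) (sym (∑-zero _)) (0≤+ 1)
∑[]≤1 {suc n} p unique = subst (_≤ 1ℤ) (sym (∑-suc _)) (bound (p zero) refl)
  where
  others : p zero ≡ true → ∀ i → p (suc i) ≡ false
  others p0 i with p (suc i) in pi
  ... | false = refl
  ... | true  with () ← unique zero (suc i) p0 pi
  bound : ∀ b → p zero ≡ b → [ b ] + ∑ (λ i → [ p (suc i) ]) ≤ 1ℤ
  bound true  p0 = ≤-reflexive (cong (λ s → 1ℤ + s) (∑[]≡0 (p ∘ suc) (others p0)))
  bound false p0 = subst (_≤ 1ℤ) (sym (+-identityˡ _))
    (∑[]≤1 (p ∘ suc) (λ i j pi pj → Fin.suc-injective (unique (suc i) (suc j) pi pj)))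

+-sum-allFin : ∀ {n} (f : Fin n → ℕ) → + List.sum (map f (allFin n)) ≡ ∑ (λ i → + f i)
+-sum-allFin f = trans (cong (λ l → + List.sum l) (map-tabulate id f)) (+-sum-tabulate f)
  where
  +-sum-tabulate : ∀ {n} (g : Fin n → ℕ) → + List.sum (tabulate g) ≡ ∑ (λ i → + g i)
  +-sum-tabulate {zero}  g = sym (∑-zero _)
  +-sum-tabulate {suc n} g = begin
    + (g zero ℕ.+ List.sum (tabulate (g ∘ suc)))   ≡⟨ pos-+ (g zero) _ ⟩
    + g zero + + List.sum (tabulate (g ∘ suc))
      ≡⟨ cong (λ s → + g zero + s) (+-sum-tabulate (g ∘ suc)) ⟩
    + g zero + ∑ (λ i → + g (suc i))               ≡⟨ ∑-suc _ ⟨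
    ∑ (λ i → + g i)                                ∎
    where open ≡-Reasoning

-- Matrices acting on vectors.

act : ∀ {n} → (Fin n → Fin n → ℤ) → (Fin n → ℤ) → Fin n → ℤ
act M x v = ∑ (λ u → M v u * x u)

act-cong : ∀ {n} (M : Fin n → Fin n → ℤ) {x z : Fin n → ℤ} → (∀ u → x u ≡ z u) → ∀ v →
           act M x v ≡ act M z v
act-cong M x≗z v = ∑-cong (λ u → cong (M v u *_) (x≗z u))

act-+ : ∀ {n} (M : Fin n → Fin n → ℤ) (x z : Fin n → ℤ) v →
        act M (λ u → x u + z u) v ≡ act M x v + act M z v
act-+ M x z v = trans (∑-cong (λ u → *-distribˡ-+ (M v u) (x u) (z u))) (∑-+ _ _)

act-* : ∀ {n} (M : Fin n → Fin n → ℤ) c (x : Fin n → ℤ) v →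
        act M (λ u → c * x u) v ≡ c * act M x v
act-* M c x v = trans (∑-cong (λ u → swap (M v u) c (x u))) (∑-* c _)
  where
  swap : ∀ m c t → m * (c * t) ≡ c * (m * t)
  swap = solve-∀

act-const : ∀ {n} (M : Fin n → Fin n → ℤ) c v → act M (λ _ → c) v ≡ c * ∑ (M v)
act-const M c v = trans (∑-cong (λ u → *-comm (M v u) c)) (∑-* c (M v))

-- By symmetry 1ᵀ(Mx) = (M1)ᵀx. This later turns the total of A d into Σ d², that of A f into `H`,
-- and that of M|y| into `G₁`.
∑-act : ∀ {n} {M : Fin n → Fin n → ℤ} → (∀ u v → M u v ≡ M v u) → (x : Fin n → ℤ) →
        ∑ (act M x) ≡ ∑ (λ u → x u * ∑ (M u))
∑-act {M = M} M-sym x = begin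
  ∑ (λ v → ∑ (λ u → M v u * x u)) ≡⟨ ∑-swap _ ⟩
  ∑ (λ u → ∑ (λ v → M v u * x u))
    ≡⟨ ∑-cong (λ u → ∑-cong (λ v → trans (cong (_* x u) (M-sym v u)) (*-comm (M u v) (x u)))) ⟩
  ∑ (λ u → ∑ (λ v → x u * M u v)) ≡⟨ ∑-cong (λ u → ∑-* (x u) (M u)) ⟩
  ∑ (λ u → x u * ∑ (M u))         ∎
  where open ≡-Reasoning

[]-∧ : ∀ b c → [ b ] * [ c ] ≡ [ b ∧ c ]
[]-∧ true  true  = refl
[]-∧ true  false = refl
[]-∧ false true  = refl
[]-∧ false false = refl

∧-true : ∀ b c → b ∧ c ≡ true → b ≡ true × c ≡ true
∧-true true true refl = refl , refl

-- Adjacency matrix, codegrees and the identity for A².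

module Adjacency {n} (G : SimpleGraph n) where

  a : Fin n → Fin n → ℤ
  a u v = [ adj G u v ]

  a-sym : ∀ u v → a u v ≡ a v u
  a-sym u v = cong [_] (SimpleGraph.sym G u v)

  deg : Fin n → ℤ
  deg v = ∑ (a v)

  codeg : Fin n → Fin n → ℤ
  codeg u v = ∑ (λ w → a u w * a v w)

  codeg-∧ : ∀ u v → codeg u v ≡ ∑ (λ w → [ adj G u w ∧ adj G v w ])
  codeg-∧ u v = ∑-cong (λ w → []-∧ (adj G u w) (adj G v w))

  codeg-diag : ∀ v → codeg v v ≡ deg v
  codeg-diag v = ∑-cong (λ w → idem (adj G v w))
    where
    idem : ∀ b → [ b ] * [ b ] ≡ [ b ]
    idem true  = refl
    idem false = refl

  codeg-sym : ∀ u v → codeg u v ≡ codeg v u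
  codeg-sym u v = ∑-cong (λ w → *-comm (a u w) (a v w))

  0≤codeg : ∀ u v → 0ℤ ≤ codeg u v
  0≤codeg u v = ∑-nonneg (λ w → 0≤[ adj G u w ] ⊗ 0≤[ adj G v w ])

  -- The codegree matrix is A Aᵀ, which is A² by symmetry.
  act-codeg : ∀ x v → act codeg x v ≡ act a (act a x) v
  act-codeg x v = begin
    ∑ (λ u → codeg v u * x u)                       ≡⟨ ∑-cong (λ u → *-comm (codeg v u) (x u)) ⟩
    ∑ (λ u → x u * codeg v u)                       ≡⟨ ∑-cong (λ u → sym (∑-* (x u) _)) ⟩
    ∑ (λ u → ∑ (λ w → x u * (a v w * a u w)))       ≡⟨ ∑-swap _ ⟩
    ∑ (λ w → ∑ (λ u → x u * (a v w * a u w)))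
      ≡⟨ ∑-cong (λ w → ∑-cong (λ u → trans (shuffle (x u) (a v w) (a u w)) (cong (λ t → a v w * (t * x u)) (a-sym u w)))) ⟩
    ∑ (λ w → ∑ (λ u → a v w * (a w u * x u)))       ≡⟨ ∑-cong (λ w → ∑-* (a v w) _) ⟩
    ∑ (λ w → a v w * act a x w)                     ∎
    where
    open ≡-Reasoning
    shuffle : ∀ p q r → p * (q * r) ≡ q * (r * p)
    shuffle = solve-∀

  -- Off the diagonal 1 − codeg, on it 0; that is, A² = J − I + D − miss.
  miss : Fin n → Fin n → ℤ
  miss u v = 1ℤ - codeg u v + δ u v * (deg u - 1ℤ)

  miss-sym : ∀ u v → miss u v ≡ miss v u
  miss-sym u v = cong₂ (λ s t → 1ℤ - s + t) (codeg-sym u v) (diagonal u v)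
    where
    diagonal : ∀ u v → δ u v * (deg u - 1ℤ) ≡ δ v u * (deg v - 1ℤ)
    diagonal u v with u Fin.≟ v | v Fin.≟ u
    ... | yes refl | yes _   = refl
    ... | no _     | no _    = refl
    ... | yes u≡v  | no v≢u  = contradiction (sym u≡v) v≢u
    ... | no u≢v   | yes v≡u = contradiction (sym v≡u) u≢v

  missed : Fin n → ℤ
  missed v = ∑ (miss v)

  act-miss : ∀ x v → act miss x v ≡ ∑ x - act a (act a x) v + (deg v - 1ℤ) * x v
  act-miss x v = begin
    ∑ (λ u → miss v u * x u)
      ≡⟨ ∑-cong (λ u → expand (codeg v u) (δ v u) (deg v) (x u)) ⟩
    ∑ (λ u → x u + ((- 1ℤ) * (codeg v u * x u) + (deg v - 1ℤ) * (δ v u * x u)))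
      ≡⟨ refl +∑ (- 1ℤ) *∑ act-codeg x v +∑ (deg v - 1ℤ) *∑ ∑-δ v x ⟩
    ∑ x + ((- 1ℤ) * act a (act a x) v + (deg v - 1ℤ) * x v)
      ≡⟨ collect (∑ x) (act a (act a x) v) ((deg v - 1ℤ) * x v) ⟩
    ∑ x - act a (act a x) v + (deg v - 1ℤ) * x v ∎
    where
    open ≡-Reasoning
    expand : ∀ w e d x → (1ℤ - w + e * (d - 1ℤ)) * x ≡ x + ((- 1ℤ) * (w * x) + (d - 1ℤ) * (e * x))
    expand = solve-∀
    collect : ∀ s t u → s + ((- 1ℤ) * t + u) ≡ s - t + u
    collect = solve-∀

  -- This is `act-miss` at the all-ones vector, where A1 = d and hence A²1 = A d.
  ∑-neighbour-deg : ∀ v → act a deg v ≡ + n + deg v - 1ℤ - missed v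
  ∑-neighbour-deg v = solved (begin
    missed v                                            ≡⟨ trans (act-const miss 1ℤ v) (*-identityˡ _) ⟨
    act miss (λ _ → 1ℤ) v                               ≡⟨ act-miss (λ _ → 1ℤ) v ⟩
    ∑ {n} (λ _ → 1ℤ) - act a (act a (λ _ → 1ℤ)) v + (deg v - 1ℤ) * 1ℤ
      ≡⟨ cong₂ (λ s t → s - t + (deg v - 1ℤ) * 1ℤ)
           (trans (∑-const n 1ℤ) (*-identityˡ (+ n)))
           (act-cong a (λ w → trans (act-const a 1ℤ w) (*-identityˡ _)) v) ⟩
    + n - act a deg v + (deg v - 1ℤ) * 1ℤ               ∎)
    where
    open ≡-Reasoning
    rearrange : ∀ n s d → s ≡ n + d - 1ℤ - (n - s + (d - 1ℤ) * 1ℤ)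
    rearrange = solve-∀
    solved : missed v ≡ + n - act a deg v + (deg v - 1ℤ) * 1ℤ → act a deg v ≡ + n + deg v - 1ℤ - missed v
    solved eq = trans (rearrange (+ n) (act a deg v) (deg v)) (cong (λ f → + n + deg v - 1ℤ - f) (sym eq))

  -- Sum `∑-neighbour-deg` over all vertices; the total of A d is Σ d². This is the count of paths
  -- of length two.
  ∑-missed : ∑ missed ≡ + n * + n + ∑ deg - + n - ∑ (λ v → deg v * deg v)
  ∑-missed = begin
    ∑ missed
      ≡⟨ ∑-cong (λ v → trans (rearrange (+ n) (deg v) (missed v))
           (cong (λ s → (+ n - 1ℤ) + (deg v + (- 1ℤ) * s)) (sym (∑-neighbour-deg v)))) ⟩
    ∑ (λ v → (+ n - 1ℤ) + (deg v + (- 1ℤ) * act a deg v))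
      ≡⟨ ∑-const n (+ n - 1ℤ) +∑ refl +∑ (- 1ℤ) *∑ ∑-act a-sym deg ⟩
    (+ n - 1ℤ) * + n + (∑ deg + (- 1ℤ) * ∑ (λ v → deg v * deg v))
      ≡⟨ collect (+ n) (∑ deg) _ ⟩
    + n * + n + ∑ deg - + n - ∑ (λ v → deg v * deg v) ∎
    where
    open ≡-Reasoning
    rearrange : ∀ n d f → f ≡ (n - 1ℤ) + (d + (- 1ℤ) * (n + d - 1ℤ - f))
    rearrange = solve-∀
    collect : ∀ n s q → (n - 1ℤ) * n + (s + (- 1ℤ) * q) ≡ n * n + s - n - q
    collect = solve-∀

  module _ (free : C4Free G) where

    a≢ : ∀ {u v} → adj G u v ≡ true → u ≢ v
    a≢ {u} uv refl with () ← trans (sym uv) (irrefl G u)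

    -- Two common neighbours w ≠ w′ of u ≠ v would close the 4-cycle u w v w′.
    codeg≤1 : ∀ {u v} → u ≢ v → codeg u v ≤ 1ℤ
    codeg≤1 {u} {v} u≢v = subst (_≤ 1ℤ) (sym (codeg-∧ u v)) (∑[]≤1 _ unique)
      where
      unique : ∀ w w′ → adj G u w ∧ adj G v w ≡ true → adj G u w′ ∧ adj G v w′ ≡ true → w ≡ w′
      unique w w′ p p′ with w Fin.≟ w′
      ... | yes w≡w′ = w≡w′
      ... | no  w≢w′ with (uw , vw) ← ∧-true _ _ p | (uw′ , vw′) ← ∧-true _ _ p′ =
        contradiction
          (u , w , v , w′
          , (a≢ uw , u≢v , a≢ uw′ , a≢ vw ∘ sym , w≢w′ , a≢ vw′)
          , uw , trans (SimpleGraph.sym G w v) vw , vw′ , trans (SimpleGraph.sym G w′ u) uw′)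
          free

    -- On the diagonal the codegree is the degree and everything cancels; elsewhere the entry is 1
    -- minus a codegree that is 0 or 1. The rest of the argument feels C₄-freeness only through the
    -- nonnegativity of `miss`.
    miss-bounds : ∀ u v → 0ℤ ≤ miss u v × miss u v ≤ 1ℤ
    miss-bounds u v with u Fin.≟ v
    ... | yes refl rewrite codeg-diag u =
      ≤-reflexive (sym (vanish (deg u))) , subst (_≤ 1ℤ) (sym (vanish (deg u))) (0≤+ 1)
      where
      vanish : ∀ d → 1ℤ - d + 1ℤ * (d - 1ℤ) ≡ 0ℤ
      vanish = solve-∀
    ... | no u≢v = ≤-from-gap (lower (codeg u v) (deg u)) (gap (codeg≤1 u≢v))
                 , ≤-from-gap (upper (codeg u v) (deg u)) (0≤codeg u v)
      where
      lower : ∀ w d → 1ℤ - w + 0ℤ * (d - 1ℤ) - 0ℤ ≡ 1ℤ - w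
      lower = solve-∀
      upper : ∀ w d → 1ℤ - (1ℤ - w + 0ℤ * (d - 1ℤ)) ≡ w
      upper = solve-∀

    0≤missed : ∀ v → 0ℤ ≤ missed v
    0≤missed v = ∑-nonneg (λ u → proj₁ (miss-bounds v u))

    missed≤n : ∀ v → missed v ≤ + n
    missed≤n v = subst (missed v ≤_) (trans (∑-const n 1ℤ) (*-identityˡ (+ n)))
      (∑-mono (λ u → proj₂ (miss-bounds v u)))

-- The handshake lemma.

<ᵇ-split : ∀ {i j} → i ≢ j → [ i <ᵇ j ] + [ j <ᵇ i ] ≡ 1ℤ
<ᵇ-split {zero}  {zero}  i≢j = contradiction refl i≢j
<ᵇ-split {zero}  {suc j} i≢j = refl
<ᵇ-split {suc i} {zero}  i≢j = refl
<ᵇ-split {suc i} {suc j} i≢j = <ᵇ-split (i≢j ∘ cong suc)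

module _ {n} (G : SimpleGraph n) where
  open Adjacency G

  private
    up : Fin n → Fin n → ℤ
    up i j = [ (toℕ i <ᵇ toℕ j) ∧ adj G i j ]

    a-split : ∀ i j → a i j ≡ up i j + up j i
    a-split i j = helper (adj G i j) refl
      where
      open ≡-Reasoning
      helper : ∀ b → adj G i j ≡ b → a i j ≡ up i j + up j i
      helper false ij = begin
        a i j          ≡⟨ cong [_] ij ⟩
        0ℤ
          ≡⟨ cong₂ _+_ (∧-false (toℕ i <ᵇ toℕ j) ij) (∧-false (toℕ j <ᵇ toℕ i) (trans (SimpleGraph.sym G j i) ij)) ⟨
        up i j + up j i ∎
        where
        ∧-false : ∀ b {c} → c ≡ false → [ b ∧ c ] ≡ 0ℤ
        ∧-false true  refl = refl
        ∧-false false refl = refl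
      helper true ij = begin
        a i j          ≡⟨ cong [_] ij ⟩
        1ℤ             ≡⟨ <ᵇ-split (i≢j ∘ Fin.toℕ-injective) ⟨
        [ toℕ i <ᵇ toℕ j ] + [ toℕ j <ᵇ toℕ i ]
          ≡⟨ cong₂ _+_ (∧-true-r (toℕ i <ᵇ toℕ j) ij) (∧-true-r (toℕ j <ᵇ toℕ i) (trans (SimpleGraph.sym G j i) ij)) ⟨
        up i j + up j i ∎
        where
        ∧-true-r : ∀ b {c} → c ≡ true → [ b ∧ c ] ≡ [ b ]
        ∧-true-r true  refl = refl
        ∧-true-r false refl = refl
        i≢j : i ≢ j
        i≢j refl with () ← trans (sym ij) (irrefl G i)

    +-if : ∀ b → + (if b then 1 else 0) ≡ [ b ]
    +-if true  = refl
    +-if false = refl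

    edgeCount-∑ : + edgeCount G ≡ ∑ (λ i → ∑ (λ j → up i j))
    edgeCount-∑ = trans (+-sum-allFin _) (∑-cong (λ i →
      trans (+-sum-allFin _) (∑-cong (λ j → +-if ((toℕ i <ᵇ toℕ j) ∧ adj G i j)))))

  -- `edgeCount` sees each edge at its increasing pair only, so A is the sum of the matrix `up` and
  -- its transpose, which have equal totals.
  handshake : ∑ deg ≡ + 2 * + edgeCount G
  handshake = begin
    ∑ (λ i → ∑ (λ j → a i j))
      ≡⟨ ∑-cong (λ i → ∑-cong (λ j → a-split i j)) ⟩
    ∑ (λ i → ∑ (λ j → up i j + up j i))                          ≡⟨ ∑-cong (λ i → ∑-+ _ _) ⟩
    ∑ (λ i → ∑ (λ j → up i j) + ∑ (λ j → up j i))                ≡⟨ ∑-+ _ _ ⟩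
    ∑ (λ i → ∑ (λ j → up i j)) + ∑ (λ i → ∑ (λ j → up j i))
      ≡⟨ cong₂ _+_ (sym edgeCount-∑) (trans (∑-swap _) (sym edgeCount-∑)) ⟩
    + edgeCount G + + edgeCount G                                ≡⟨ double (+ edgeCount G) ⟩
    + 2 * + edgeCount G                                          ∎
    where
    open ≡-Reasoning
    double : ∀ e → e + e ≡ + 2 * e
    double = solve-∀

-- Parity, absolute values and signs of integers.

-- If the difference vanished, 1 would be even. Applied to y, this is where the integrality of the
-- degrees enters.
1≤∣2i-odd∣ : ∀ i j → 1ℤ ≤ + ∣ + 2 * i - (+ 2 * j + 1ℤ) ∣
1≤∣2i-odd∣ i j = +≤+ (ℕ.n≢0⇒n>0 (λ abs≡0 → even≢odd (i - j) (begin
  + 2 * (i - j)                                ≡⟨ shift i j ⟩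
  + 2 * i - (+ 2 * j + 1ℤ) + 1ℤ
    ≡⟨ cong (_+ 1ℤ) (∣i∣≡0⇒i≡0 {+ 2 * i - (+ 2 * j + 1ℤ)} abs≡0) ⟩
  1ℤ                                           ∎)))
  where
  open ≡-Reasoning
  shift : ∀ i j → + 2 * (i - j) ≡ + 2 * i - (+ 2 * j + 1ℤ) + 1ℤ
  shift = solve-∀
  even≢odd : ∀ i → + 2 * i ≢ 1ℤ
  even≢odd i eq = ℕ.even≢odd ∣ i ∣ 0 (trans (sym (abs-* (+ 2) i)) (cong ∣_∣ eq))

i≤∣i∣ : ∀ i → i ≤ + ∣ i ∣
i≤∣i∣ (+ _)    = ≤-refl
i≤∣i∣ -[1+ _ ] = -≤+

-i*-i≡i*i : ∀ i → - i * - i ≡ i * i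
-i*-i≡i*i = solve-∀

abs-rec : ∀ i (P : ℤ → Set) → P i → P (- i) → P (+ ∣ i ∣)
abs-rec i P p₊ p₋ with +∣i∣≡i⊎+∣i∣≡-i i
... | inj₁ eq = subst P (sym eq) p₊
... | inj₂ eq = subst P (sym eq) p₋

∣i∣²≡i² : ∀ i → + ∣ i ∣ * + ∣ i ∣ ≡ i * i
∣i∣²≡i² i = abs-rec i (λ a → a * a ≡ i * i) refl (-i*-i≡i*i i)

0≤∣i∣+i : ∀ i → 0ℤ ≤ + ∣ i ∣ + i
0≤∣i∣+i i = subst (λ a → 0ℤ ≤ + a + i) (∣-i∣≡∣i∣ i)
  (subst (λ j → 0ℤ ≤ + ∣ - i ∣ + j) (neg-involutive i) (gap (i≤∣i∣ (- i))))

0≤∣i∣-i : ∀ i → 0ℤ ≤ + ∣ i ∣ - i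
0≤∣i∣-i i = gap (i≤∣i∣ i)

0≤i*i : ∀ i → 0ℤ ≤ i * i
0≤i*i i = subst (0ℤ ≤_) (∣i∣²≡i² i) (0≤+ ∣ i ∣ ⊗ 0≤+ ∣ i ∣)

1≤⇒0≤ : ∀ {i} → 1ℤ ≤ i → 0ℤ ≤ i
1≤⇒0≤ = ≤-trans (0≤+ 1)

1≤* : ∀ {i j} → 1ℤ ≤ i → 1ℤ ≤ j → 1ℤ ≤ i * j
1≤* {i} {j} 1≤i 1≤j = ≤-from-gap (split i j) (gap 1≤i ⊗ 1≤⇒0≤ 1≤j ⊕ gap 1≤j)
  where
  split : ∀ i j → i * j - 1ℤ ≡ (i - 1ℤ) * j + (j - 1ℤ)
  split = solve-∀

0≤-cancel : ∀ {i j} → 1ℤ ≤ i → 0ℤ ≤ i * j → 0ℤ ≤ j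
0≤-cancel {i} {j} 1≤i 0≤ij = *-cancelˡ-≤-pos 0ℤ j i {{positive (suc[i]≤j⇒i<j 1≤i)}}
  (subst (_≤ i * j) (sym (*-zeroʳ i)) 0≤ij)

-- The numerical contradiction.

-- Compare orders, with n close to k². The left side of the main inequality is about 4 k² n because
-- S ≥ n. Eliminating H and then G, the right side is about 24 k F + 8 k Q + 4 t n. The bounds F ≤
-- kn/20, Q ≤ kn/5 and t ≤ n/40 make this at most (1.2 + 1.6 + 0.1) k² n up to lower order, which is
-- too small.
moments-contradictory : ∀ {n k r F Q G H S t} →
  n ≡ k * k + r → 0ℤ ≤ r → 0ℤ ≤ k - + 40 * r - + 40 →
  1ℤ ≤ n → 1ℤ ≤ k → 0ℤ ≤ F → 0ℤ ≤ Q →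
  (+ 4 * k * k - + 8 * k + + 4 * r) * S
    ≤ + 2 * Q + (+ 4 * G + (+ 8 * H + (+ 4 * (+ 2 * k + 1ℤ) * F + (+ 4 * t + (+ 8 * r + + 6)) * n))) →
  n ≤ S →
  0ℤ ≤ + 8 * k * n - + 40 * (+ 4 * F + Q) →
  + 40 * t ≤ n →
  k * G ≤ k * k * F + n * Q →
  + 2 * H ≤ (+ 2 * k + 1ℤ) * F + G →
  ⊥
moments-contradictory {n} {k} {r} {F} {Q} {G} {H} {S} {t} refl 0≤r 0≤κ 1≤n 1≤k 0≤F 0≤Q
  main n≤S FQ t≤ G≤ H≤ =
  <⇒≱ (suc[i]≤j⇒i<j ≤-refl) (≤-trans 1≤X X≤0)
  where
  0≤k = 1≤⇒0≤ 1≤k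
  0≤n = 1≤⇒0≤ 1≤n
  0≤k-40 : 0ℤ ≤ k - + 40
  0≤k-40 = subst (0ℤ ≤_) (eq k r) (0≤κ ⊕ 0≤+ 40 ⊗ 0≤r)
    where
    eq : ∀ k r → (k - + 40 * r - + 40) + + 40 * r ≡ k - + 40
    eq = solve-∀
  0≤K : 0ℤ ≤ + 4 * k * k - + 8 * k + + 4 * r
  0≤K = subst (0ℤ ≤_) (eq k r) (0≤+ 4 ⊗ 0≤k ⊗ 0≤k-40 ⊕ 0≤+ 152 ⊗ 0≤k ⊕ 0≤+ 4 ⊗ 0≤r)
    where
    eq : ∀ k r → + 4 * (k * (k - + 40)) + (+ 152 * k + + 4 * r) ≡ + 4 * k * k - + 8 * k + + 4 * r
    eq = solve-∀
  Q≤ : 0ℤ ≤ + 8 * k * n - + 40 * Q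
  Q≤ = subst (0ℤ ≤_) (eq k n F Q) (FQ ⊕ 0≤+ 160 ⊗ 0≤F)
    where
    eq : ∀ k n F Q → + 8 * k * n - + 40 * (+ 4 * F + Q) + + 160 * F ≡ + 8 * k * n - + 40 * Q
    eq = solve-∀
  F≤ : 0ℤ ≤ + 8 * k * n - + 160 * F
  F≤ = subst (0ℤ ≤_) (eq k n F Q) (FQ ⊕ 0≤+ 40 ⊗ 0≤Q)
    where
    eq : ∀ k n F Q → + 8 * k * n - + 40 * (+ 4 * F + Q) + + 40 * Q ≡ + 8 * k * n - + 160 * F
    eq = solve-∀
  -- `X` is the slack after multiplication by 40 k; its leading coefficient is 44 = 40 (4 - 2.9).
  -- Writing it with k (k - 40) makes positivity visible from k ≥ 40.
  X : ℤ
  X = k * (n * (+ 44 * (k * (k - + 40)) + (+ 1400 * k + (+ 92 * r + + 80))))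
  1≤X : 1ℤ ≤ X
  1≤X = 1≤* 1≤k (1≤* 1≤n (≤-from-gap (eq k r)
    (0≤+ 44 ⊗ 0≤k ⊗ 0≤k-40 ⊕ 0≤+ 1400 ⊗ 0≤k ⊕ 0≤+ 92 ⊗ 0≤r ⊕ 0≤+ 79)))
    where
    eq : ∀ k r → + 44 * (k * (k - + 40)) + (+ 1400 * k + (+ 92 * r + + 80)) - 1ℤ
               ≡ + 44 * (k * (k - + 40)) + (+ 1400 * k + (+ 92 * r + + 79))
    eq = solve-∀
  -- The factor 40 k clears the denominators of the bounds on t, F, Q and G.
  certificate : ∀ k r F Q G H S t →
    let n = k * k + r; K = + 4 * k * k - + 8 * k + + 4 * r in
    0ℤ - k * (n * (+ 44 * (k * (k - + 40)) + (+ 1400 * k + (+ 92 * r + + 80)))) ≡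
      + 40 * (k * (+ 2 * Q + (+ 4 * G + (+ 8 * H + (+ 4 * (+ 2 * k + 1ℤ) * F
                   + (+ 4 * t + (+ 8 * r + + 6)) * n))) - K * S))
    + (+ 40 * (k * (K * (S - n)))
    + (+ 160 * (k * ((+ 2 * k + 1ℤ) * F + G - + 2 * H))
    + (+ 320 * (k * k * F + n * Q - k * G)
    + ((+ 2 * k + + 8 * n) * (+ 8 * k * n - + 40 * Q)
    + ((+ 6 * (k * k) + + 2 * k) * (+ 8 * k * n - + 160 * F)
    + (+ 4 * (k * (n * (n - + 40 * t)))
    + + 8 * (k * (n * (k - + 40 * r - + 40)))))))))
  certificate = solve-∀
  X≤0 : X ≤ 0ℤ
  X≤0 = ≤-from-gap (certificate k r F Q G H S t)
    ( 0≤+ 40 ⊗ 0≤k ⊗ gap main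
    ⊕ 0≤+ 40 ⊗ 0≤k ⊗ 0≤K ⊗ gap n≤S
    ⊕ 0≤+ 160 ⊗ 0≤k ⊗ gap H≤
    ⊕ 0≤+ 320 ⊗ gap G≤
    ⊕ (0≤+ 2 ⊗ 0≤k ⊕ 0≤+ 8 ⊗ 0≤n) ⊗ Q≤
    ⊕ (0≤+ 6 ⊗ 0≤k ⊗ 0≤k ⊕ 0≤+ 2 ⊗ 0≤k) ⊗ F≤
    ⊕ 0≤+ 4 ⊗ 0≤k ⊗ 0≤n ⊗ gap t≤
    ⊕ 0≤+ 8 ⊗ 0≤k ⊗ 0≤n ⊗ 0≤κ)

-- The degree excess y and its moments.

module Excess {n} (G : SimpleGraph n) (free : C4Free G) (k r : ℤ)
              (0≤k : 0ℤ ≤ k) (0≤r : 0ℤ ≤ r) (n≡k²+r : + n ≡ k * k + r) where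
  open Adjacency G

  -- Twice the deviation of the degree from k + ½, the average degree at kn/2 + n/4 edges; the
  -- doubling keeps it an integer.
  y : Fin n → ℤ
  y v = + 2 * deg v - (+ 2 * k + 1ℤ)

  ∣y∣ : Fin n → ℤ
  ∣y∣ v = + ∣ y v ∣

  f : Fin n → ℤ
  f = missed

  F Q Y G₁ H S : ℤ
  F  = ∑ f
  Q  = ∑ (λ v → y v * y v)
  Y  = ∑ y
  G₁ = ∑ (λ v → ∣y∣ v * f v)
  H  = ∑ (λ v → f v * deg v)
  S  = ∑ ∣y∣

  Y-deg : Y ≡ + 2 * ∑ deg - (+ 2 * k + 1ℤ) * + n
  Y-deg = begin
    ∑ (λ v → + 2 * deg v + (- (+ 2 * k + 1ℤ)))  ≡⟨ + 2 *∑ refl +∑ ∑-const n (- (+ 2 * k + 1ℤ)) ⟩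
    + 2 * ∑ deg + (- (+ 2 * k + 1ℤ)) * + n
      ≡⟨ cong (λ s → + 2 * ∑ deg + s) (sym (neg-distribˡ-* (+ 2 * k + 1ℤ) (+ n))) ⟩
    + 2 * ∑ deg - (+ 2 * k + 1ℤ) * + n          ∎
    where open ≡-Reasoning

  Q-deg : Q ≡ + 4 * ∑ (λ v → deg v * deg v) - + 4 * (+ 2 * k + 1ℤ) * ∑ deg
            + (+ 2 * k + 1ℤ) * (+ 2 * k + 1ℤ) * + n
  Q-deg = begin
    ∑ (λ v → y v * y v)
      ≡⟨ ∑-cong (λ v → square (deg v) c) ⟩
    ∑ (λ v → + 4 * (deg v * deg v) + ((- (+ 4 * c)) * deg v + c * c))
      ≡⟨ + 4 *∑ refl +∑ (- (+ 4 * c)) *∑ refl +∑ ∑-const n (c * c) ⟩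
    + 4 * ∑ (λ v → deg v * deg v) + ((- (+ 4 * c)) * ∑ deg + c * c * + n)
      ≡⟨ collect (∑ (λ v → deg v * deg v)) (∑ deg) c (+ n) ⟩
    + 4 * ∑ (λ v → deg v * deg v) - + 4 * c * ∑ deg + c * c * + n ∎
    where
    open ≡-Reasoning
    c = + 2 * k + 1ℤ
    square : ∀ d c → (+ 2 * d - c) * (+ 2 * d - c) ≡ + 4 * (d * d) + ((- (+ 4 * c)) * d + c * c)
    square = solve-∀
    collect : ∀ q d c n → + 4 * q + ((- (+ 4 * c)) * d + c * c * n) ≡ + 4 * q - + 4 * c * d + c * c * n
    collect = solve-∀

  -- Σ d² cancels between `∑-missed` and `Q-deg`. As `F` and `Q` are nonnegative, this bounds `Y`
  -- from above, and a lower bound on `Y` bounds both `F` and `Q`.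
  4F+Q : + 4 * F + Q ≡ (+ 4 * r - + 3) * + n - + 4 * k * Y
  4F+Q = begin
    + 4 * F + Q
      ≡⟨ cong₂ (λ s t → + 4 * s + t) ∑-missed Q-deg ⟩
    + 4 * (+ n * + n + D - + n - D₂)
      + (+ 4 * D₂ - + 4 * (+ 2 * k + 1ℤ) * D + (+ 2 * k + 1ℤ) * (+ 2 * k + 1ℤ) * + n)
      ≡⟨ regroup (+ n) k D D₂ ⟩
    (+ 4 * (+ n - k * k) - + 3) * + n - + 4 * k * (+ 2 * D - (+ 2 * k + 1ℤ) * + n)
      ≡⟨ cong₂ (λ s t → (+ 4 * s - + 3) * + n - + 4 * k * t) n-k² (sym Y-deg) ⟩
    (+ 4 * r - + 3) * + n - + 4 * k * Y ∎
    where
    open ≡-Reasoning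
    D = ∑ deg
    D₂ = ∑ (λ v → deg v * deg v)
    regroup : ∀ n k d q →
      + 4 * (n * n + d - n - q) + (+ 4 * q - + 4 * (+ 2 * k + 1ℤ) * d + (+ 2 * k + 1ℤ) * (+ 2 * k + 1ℤ) * n)
      ≡ (+ 4 * (n - k * k) - + 3) * n - + 4 * k * (+ 2 * d - (+ 2 * k + 1ℤ) * n)
    regroup = solve-∀
    cancel : ∀ k r → k * k + r - k * k ≡ r
    cancel = solve-∀
    n-k² : + n - k * k ≡ r
    n-k² = trans (cong (_- k * k) n≡k²+r) (cancel k r)

  -- `∑-neighbour-deg` rewritten for y: A y = -(k - ½) y - 2 f + (2 r - 3/2), so y is an eigenvector
  -- up to f and a constant.
  ∑-neighbour-y : ∀ v → + 2 * act a y v ≡ (+ 4 * r - + 3) + ((- (+ 4)) * f v + (- (+ 2 * k - 1ℤ)) * y v)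
  ∑-neighbour-y v = begin
    + 2 * act a y v
      ≡⟨ cong (+ 2 *_) (trans (act-+ a (λ u → + 2 * deg u) (λ _ → - c) v)
           (cong₂ _+_ (act-* a (+ 2) deg v) (act-const a (- c) v))) ⟩
    + 2 * (+ 2 * act a deg v + - c * deg v)
      ≡⟨ cong (λ s → + 2 * (+ 2 * s + - c * deg v))
           (trans (∑-neighbour-deg v) (cong (λ m → m + deg v - 1ℤ - f v) n≡k²+r)) ⟩
    + 2 * (+ 2 * (k * k + r + deg v - 1ℤ - f v) + - c * deg v)
      ≡⟨ regroup k r (deg v) (f v) ⟩
    (+ 4 * r - + 3) + ((- (+ 4)) * f v + (- (+ 2 * k - 1ℤ)) * y v) ∎
    where
    open ≡-Reasoning
    c = + 2 * k + 1ℤ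
    regroup : ∀ k r d f → + 2 * (+ 2 * (k * k + r + d - 1ℤ - f) + - (+ 2 * k + 1ℤ) * d)
              ≡ (+ 4 * r - + 3) + ((- (+ 4)) * f + (- (+ 2 * k - 1ℤ)) * (+ 2 * d - (+ 2 * k + 1ℤ)))
    regroup = solve-∀

  ∑-walk-y : ∀ v → + 2 * act a (act a y) v ≡
             (+ 4 * r - + 3) * deg v + ((- (+ 4)) * act a f v + (- (+ 2 * k - 1ℤ)) * act a y v)
  ∑-walk-y v = begin
    + 2 * act a (act a y) v                ≡⟨ act-* a (+ 2) (act a y) v ⟨
    act a (λ u → + 2 * act a y u) v        ≡⟨ act-cong a ∑-neighbour-y v ⟩
    act a (λ u → (+ 4 * r - + 3) + ((- (+ 4)) * f u + (- (+ 2 * k - 1ℤ)) * y u)) v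
      ≡⟨ act-+ a (λ _ → + 4 * r - + 3) (λ u → (- (+ 4)) * f u + (- (+ 2 * k - 1ℤ)) * y u) v ⟩
    act a (λ _ → + 4 * r - + 3) v + act a (λ u → (- (+ 4)) * f u + (- (+ 2 * k - 1ℤ)) * y u) v
      ≡⟨ cong₂ _+_ (act-const a (+ 4 * r - + 3) v)
           (trans (act-+ a (λ u → (- (+ 4)) * f u) (λ u → (- (+ 2 * k - 1ℤ)) * y u) v)
                  (cong₂ _+_ (act-* a (- (+ 4)) f v) (act-* a (- (+ 2 * k - 1ℤ)) y v))) ⟩
    (+ 4 * r - + 3) * deg v + ((- (+ 4)) * act a f v + (- (+ 2 * k - 1ℤ)) * act a y v) ∎
    where open ≡-Reasoning

  -- With m = 2k - 1 and c = 4r - 3 this is m² - 2m + c: m² comes from applying the approximate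
  -- eigenvalue twice, 2m from the diagonal D - I, and c from the constant in `∑-neighbour-y`.
  K : ℤ
  K = + 4 * k * k - + 8 * k + + 4 * r

  -- Equate two values of 4 A²y: one from `act-miss`, where 4 (d - 1) y = 2 y² + 2 (2k - 1) y, the
  -- other from `∑-walk-y` followed by `∑-neighbour-y`. The factor `K` is of order 4 k², so y is
  -- small wherever the right side is.
  y-equation : ∀ v → K * y v ≡ + 2 * (y v * y v) + + 4 * Y - + 4 * act miss y v - + 2 * (+ 4 * r - + 3)
                               + + 8 * act a f v - + 4 * (+ 2 * k - 1ℤ) * f v
  y-equation v = sym (begin
    + 2 * (y v * y v) + + 4 * Y - + 4 * act miss y v - + 2 * c + + 8 * af - + 4 * m * f v
      ≡⟨ cong (λ e → + 2 * (y v * y v) + + 4 * Y - + 4 * e - + 2 * c + + 8 * af - + 4 * m * f v)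
           (act-miss y v) ⟩
    + 2 * (y v * y v) + + 4 * Y - + 4 * (Y - p₂ + (deg v - 1ℤ) * y v) - + 2 * c + + 8 * af - + 4 * m * f v
      ≡⟨ isolate₂ (y v) Y p₂ (deg v) c af m (f v) ⟩
    + 2 * (y v * y v) - + 4 * (deg v - 1ℤ) * y v - + 2 * c + + 8 * af - + 4 * m * f v + + 2 * (+ 2 * p₂)
      ≡⟨ cong (λ e → + 2 * (y v * y v) - + 4 * (deg v - 1ℤ) * y v - + 2 * c + + 8 * af - + 4 * m * f v + + 2 * e)
           (∑-walk-y v) ⟩
    + 2 * (y v * y v) - + 4 * (deg v - 1ℤ) * y v - + 2 * c + + 8 * af - + 4 * m * f v
      + + 2 * (c * deg v + ((- (+ 4)) * af + (- m) * p₁))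
      ≡⟨ isolate₁ (y v) p₁ (deg v) c af m (f v) ⟩
    + 2 * (y v * y v) - + 4 * (deg v - 1ℤ) * y v - + 2 * c - + 4 * m * f v + + 2 * c * deg v + (- m) * (+ 2 * p₁)
      ≡⟨ cong (λ e → + 2 * (y v * y v) - + 4 * (deg v - 1ℤ) * y v - + 2 * c - + 4 * m * f v + + 2 * c * deg v + (- m) * e)
           (∑-neighbour-y v) ⟩
    + 2 * (y v * y v) - + 4 * (deg v - 1ℤ) * y v - + 2 * c - + 4 * m * f v + + 2 * c * deg v
      + (- m) * (c + ((- (+ 4)) * f v + (- m) * y v))
      ≡⟨ regroup k r (deg v) (f v) ⟩
    K * y v ∎)
    where
    open ≡-Reasoning
    c = + 4 * r - + 3
    m = + 2 * k - 1ℤ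
    af = act a f v
    p₁ = act a y v
    p₂ = act a (act a y) v
    isolate₂ : ∀ y Y p₂ d c af m f →
      + 2 * (y * y) + + 4 * Y - + 4 * (Y - p₂ + (d - 1ℤ) * y) - + 2 * c + + 8 * af - + 4 * m * f
      ≡ + 2 * (y * y) - + 4 * (d - 1ℤ) * y - + 2 * c + + 8 * af - + 4 * m * f + + 2 * (+ 2 * p₂)
    isolate₂ = solve-∀
    isolate₁ : ∀ y p₁ d c af m f →
      + 2 * (y * y) - + 4 * (d - 1ℤ) * y - + 2 * c + + 8 * af - + 4 * m * f
        + + 2 * (c * d + ((- (+ 4)) * af + (- m) * p₁))
      ≡ + 2 * (y * y) - + 4 * (d - 1ℤ) * y - + 2 * c - + 4 * m * f + + 2 * c * d + (- m) * (+ 2 * p₁)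
    isolate₁ = solve-∀
    regroup : ∀ k r d f → let y = + 2 * d - (+ 2 * k + 1ℤ); c = + 4 * r - + 3; m = + 2 * k - 1ℤ in
      + 2 * (y * y) - + 4 * (d - 1ℤ) * y - + 2 * c - + 4 * m * f + + 2 * c * d
        + (- m) * (c + ((- (+ 4)) * f + (- m) * y))
      ≡ (+ 4 * k * k - + 8 * k + + 4 * r) * y
    regroup = solve-∀

  0≤act-miss : ∀ {x} → (∀ u → 0ℤ ≤ x u) → ∀ v → 0ℤ ≤ act miss x v
  0≤act-miss 0≤x v = ∑-nonneg (λ u → proj₁ (miss-bounds free v u) ⊗ 0≤x u)

  0≤act-f : ∀ v → 0ℤ ≤ act a f v
  0≤act-f v = ∑-nonneg (λ u → 0≤[ adj G v u ] ⊗ 0≤missed free u)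

  -- With its companion below this says |M y| ≤ M|y|: the nonnegative matrix M is applied to |y| + y
  -- and |y| - y.
  0≤∣miss-y∣+miss-y : ∀ v → 0ℤ ≤ act miss ∣y∣ v + act miss y v
  0≤∣miss-y∣+miss-y v = subst (0ℤ ≤_) (act-+ miss ∣y∣ y v) (0≤act-miss (λ u → 0≤∣i∣+i (y u)) v)

  0≤∣miss-y∣-miss-y : ∀ v → 0ℤ ≤ act miss ∣y∣ v - act miss y v
  0≤∣miss-y∣-miss-y v = subst (0ℤ ≤_)
    (trans (act-+ miss ∣y∣ (λ u → (- 1ℤ) * y u) v)
      (cong (λ e → act miss ∣y∣ v + e) (trans (act-* miss (- 1ℤ) y v) (-1*i≡-i _))))
    (0≤act-miss (λ u → subst (λ z → 0ℤ ≤ ∣y∣ u + z) (sym (-1*i≡-i (y u))) (0≤∣i∣-i (y u))) v)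

  -- A common upper bound for `K` y and -`K` y: each term of `y-equation` is replaced by one
  -- dominating it with either sign. The constant 8 r + 6 dominates both -2 (4 r - 3) and 2 (4 r -
  -- 3).
  majorant : ℤ → Fin n → ℤ
  majorant t v =
    + 2 * (y v * y v) + (+ 4 * act miss ∣y∣ v + (+ 8 * act a f v + (+ 4 * (+ 2 * k + 1ℤ) * f v + (+ 4 * t + (+ 8 * r + + 6)))))

  y-bound : ∀ {t} → Y ≤ t → - Y ≤ t → ∀ v →
            K * ∣y∣ v ≤ majorant t v
  y-bound {t} Y≤t -Y≤t v = abs-rec (y v)
    (λ z → K * z ≤ majorant t v)
    (subst (_≤ majorant t v) (sym (y-equation v))
      (≤-from-gap (gap₊ (y v) (act miss ∣y∣ v) (act miss y v) (act a f v) (f v) k r t Y)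
        (0≤+ 4 ⊗ 0≤∣miss-y∣+miss-y v ⊕ 0≤+ 16 ⊗ 0≤k ⊗ 0≤missed free v ⊕ 0≤+ 4 ⊗ gap Y≤t ⊕ 0≤+ 16 ⊗ 0≤r)))
    (subst (_≤ majorant t v) (trans (cong -_ (sym (y-equation v))) (neg-distribʳ-* K (y v)))
      (≤-from-gap (gap₋ (y v) (act miss ∣y∣ v) (act miss y v) (act a f v) (f v) k r t Y)
        (0≤+ 4 ⊗ 0≤i*i (y v) ⊕ 0≤+ 4 ⊗ 0≤∣miss-y∣-miss-y v ⊕ 0≤+ 16 ⊗ 0≤act-f v ⊕ 0≤+ 8 ⊗ 0≤missed free v
          ⊕ 0≤+ 4 ⊗ gap -Y≤t ⊕ 0≤+ 12)))
    where
    gap₊ : ∀ y em e af f k r t Y →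
      + 2 * (y * y) + (+ 4 * em + (+ 8 * af + (+ 4 * (+ 2 * k + 1ℤ) * f + (+ 4 * t + (+ 8 * r + + 6)))))
        - (+ 2 * (y * y) + + 4 * Y - + 4 * e - + 2 * (+ 4 * r - + 3) + + 8 * af - + 4 * (+ 2 * k - 1ℤ) * f)
      ≡ + 4 * (em + e) + (+ 16 * (k * f) + (+ 4 * (t - Y) + + 16 * r))
    gap₊ = solve-∀
    gap₋ : ∀ y em e af f k r t Y →
      + 2 * (y * y) + (+ 4 * em + (+ 8 * af + (+ 4 * (+ 2 * k + 1ℤ) * f + (+ 4 * t + (+ 8 * r + + 6)))))
        - - (+ 2 * (y * y) + + 4 * Y - + 4 * e - + 2 * (+ 4 * r - + 3) + + 8 * af - + 4 * (+ 2 * k - 1ℤ) * f)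
      ≡ + 4 * (y * y) + (+ 4 * (em - e) + (+ 16 * af + (+ 8 * f + (+ 4 * (t - - Y) + + 12))))
    gap₋ = solve-∀

  y-bound-∑ : ∀ {t} → Y ≤ t → - Y ≤ t →
    K * S ≤ + 2 * Q + (+ 4 * G₁ + (+ 8 * H + (+ 4 * (+ 2 * k + 1ℤ) * F + (+ 4 * t + (+ 8 * r + + 6)) * + n)))
  y-bound-∑ {t} Y≤t -Y≤t = begin
    K * S                    ≡⟨ ∑-* K ∣y∣ ⟨
    ∑ (λ v → K * ∣y∣ v)      ≤⟨ ∑-mono (y-bound Y≤t -Y≤t) ⟩
    ∑ (majorant t)
      -- The row sums of `miss` are f and those of `a` are the degrees, so the two matrix terms
      -- total `G₁` and `H`.
      ≡⟨ + 2 *∑ refl +∑ + 4 *∑ ∑-act miss-sym ∣y∣ +∑ + 8 *∑ ∑-act a-sym f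
         +∑ (+ 4 * (+ 2 * k + 1ℤ)) *∑ refl +∑ ∑-const n (+ 4 * t + (+ 8 * r + + 6)) ⟩
    + 2 * Q + (+ 4 * G₁ + (+ 8 * H + (+ 4 * (+ 2 * k + 1ℤ) * F + (+ 4 * t + (+ 8 * r + + 6)) * + n))) ∎
    where open ≤-Reasoning

  n≤S : + n ≤ S
  n≤S = subst (_≤ S) (trans (∑-const n 1ℤ) (*-identityˡ (+ n)))
    (∑-mono (λ v → 1≤∣2i-odd∣ (deg v) k))

  0≤F : 0ℤ ≤ F
  0≤F = ∑-nonneg (0≤missed free)

  0≤Q : 0ℤ ≤ Q
  0≤Q = ∑-nonneg (λ v → 0≤i*i (y v))

  G₁-bound : k * G₁ ≤ k * k * F + + n * Q
  G₁-bound = begin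
    k * G₁                                        ≡⟨ ∑-* k _ ⟨
    ∑ (λ v → k * (∣y∣ v * f v))                   ≤⟨ ∑-mono bound ⟩
    ∑ (λ v → k * k * f v + + n * (y v * y v))     ≡⟨ (k * k) *∑ refl +∑ + n *∑ refl ⟩
    k * k * F + + n * Q                           ∎
    where
    open ≤-Reasoning
    -- k |y| ≤ k² + y² and 0 ≤ f ≤ n.
    amgm : ∀ k y f n → k * k * f + n * (y * y) - k * (y * f)
                     ≡ f * ((k - y) * (k - y)) + (k * y * f + (n - f) * (y * y))
    amgm = solve-∀
    bound : ∀ v → k * (∣y∣ v * f v) ≤ k * k * f v + + n * (y v * y v)
    bound v = subst (λ s → k * (∣y∣ v * f v) ≤ k * k * f v + + n * s) (∣i∣²≡i² (y v))
      (≤-from-gap (amgm k (∣y∣ v) (f v) (+ n))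
        (0≤missed free v ⊗ 0≤i*i (k - ∣y∣ v) ⊕ (0≤k ⊗ 0≤+ _) ⊗ 0≤missed free v
          ⊕ gap (missed≤n free v) ⊗ 0≤i*i (∣y∣ v)))

  -- Multiply 2 d = 2k + 1 + y ≤ 2k + 1 + |y| by f ≥ 0.
  H-bound : + 2 * H ≤ (+ 2 * k + 1ℤ) * F + G₁
  H-bound = begin
    + 2 * H                                              ≡⟨ ∑-* (+ 2) _ ⟨
    ∑ (λ v → + 2 * (f v * deg v))
      ≤⟨ ∑-mono (λ v → ≤-from-gap (excess k (deg v) (f v) (∣y∣ v))
                                                              (gap (i≤∣i∣ (y v)) ⊗ 0≤missed free v)) ⟩
    ∑ (λ v → (+ 2 * k + 1ℤ) * f v + ∣y∣ v * f v)         ≡⟨ (+ 2 * k + 1ℤ) *∑ refl +∑ refl ⟩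
    (+ 2 * k + 1ℤ) * F + G₁                              ∎
    where
    open ≤-Reasoning
    excess : ∀ k d f m → (+ 2 * k + 1ℤ) * f + m * f - + 2 * (f * d)
                       ≡ (m - (+ 2 * d - (+ 2 * k + 1ℤ))) * f
    excess = solve-∀

  module _ (1≤k : 1ℤ ≤ k) (0≤κ : 0ℤ ≤ k - + 40 * r - + 40) where

    40Y≤n : + 40 * Y ≤ + n
    -- From 4F + Q ≥ 0 one gets 40 k Y ≤ (40 r - 30) n, and 40 r ≤ k - 40 makes this at most (k -
    -- 70) n; hence the 70.
    40Y≤n = 0≤i-j⇒j≤i (0≤-cancel 1≤k (subst (0ℤ ≤_) eq
      ((0≤κ ⊕ 0≤+ 70) ⊗ 0≤+ n ⊕ 0≤+ 10 ⊗ (0≤+ 4 ⊗ 0≤F ⊕ 0≤Q))))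
      where
      open ≡-Reasoning
      regroup : ∀ k r n Y →
        (k - + 40 * r - + 40 + + 70) * n + + 10 * ((+ 4 * r - + 3) * n - + 4 * k * Y) ≡ k * (n - + 40 * Y)
      regroup = solve-∀
      eq : (k - + 40 * r - + 40 + + 70) * + n + + 10 * (+ 4 * F + Q) ≡ k * (+ n - + 40 * Y)
      eq = trans (cong (λ s → (k - + 40 * r - + 40 + + 70) * + n + + 10 * s) 4F+Q) (regroup k r (+ n) Y)

    -- Otherwise -n ≤ 40 Y, which with `40Y≤n` gives |Y| ≤ n/40. The lower bound also makes 4F + Q
    -- small, and `moments-contradictory` applies with t = |Y|.
    excess-small : + 40 * Y ℤ.< - + n
    excess-small = ≰⇒> (λ -n≤40Y →
      moments-contradictory {t = + ∣ Y ∣} n≡k²+r 0≤r 0≤κ 1≤n 1≤k 0≤F 0≤Q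
        (y-bound-∑ (i≤∣i∣ Y) (subst (λ a → - Y ≤ + a) (∣-i∣≡∣i∣ Y) (i≤∣i∣ (- Y))))
        n≤S (FQ (gap -n≤40Y))
        (abs-rec Y (λ t → + 40 * t ≤ + n) 40Y≤n (≤-from-gap (flip (+ n) Y) (gap -n≤40Y)))
        G₁-bound H-bound)
      where
      flip : ∀ n Y → n - + 40 * - Y ≡ + 40 * Y - - n
      flip = solve-∀
      1≤n : 1ℤ ≤ + n
      1≤n = subst (1ℤ ≤_) (sym n≡k²+r)
        (≤-trans (1≤* 1≤k 1≤k) (≤-from-gap (cancel (k * k) r) 0≤r))
        where
        cancel : ∀ i r → i + r - i ≡ r
        cancel = solve-∀
      -- In `4F+Q` the term -4 k Y is at most kn/10, and so is (4 r - 3) n because 40 r ≤ k;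
      -- together kn/5.
      FQ : 0ℤ ≤ + 40 * Y - - + n → 0ℤ ≤ + 8 * k * + n - + 40 * (+ 4 * F + Q)
      FQ 0≤40Y+n = subst (0ℤ ≤_)
        (trans (regroup k r (+ n) Y) (cong (λ s → + 8 * k * + n - + 40 * s) (sym 4F+Q)))
        (0≤+ 4 ⊗ (0≤κ ⊕ 0≤+ 70) ⊗ 0≤+ n ⊕ 0≤+ 4 ⊗ 0≤k ⊗ 0≤40Y+n)
        where
        regroup : ∀ k r n Y → + 4 * ((k - + 40 * r - + 40 + + 70) * n) + + 4 * (k * (+ 40 * Y - - n))
                  ≡ + 8 * k * n - + 40 * ((+ 4 * r - + 3) * n - + 4 * k * Y)
        regroup = solve-∀

-- From the degree excess to the edge bound.

-- The hypothesis rearranges to A ≤ 2 q k n, and k² ≤ n replaces k by the square root of n once both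
-- sides are squared. Squaring needs A ≥ 0; a negative A is covered by the first alternative of
-- `BoundHolds`.
bound-from-excess : ∀ p q {n} (G : SimpleGraph n) (k : ℕ) → + k * + k ≤ + n →
  + q * (+ 2 * (+ 2 * + edgeCount G) - (+ 2 * + k + 1ℤ) * + n) ≤ - (+ 4 * + p * + n) →
  BoundHolds p q n (edgeCount G)
bound-from-excess p q {n} G k k²≤n small = by-sign (≤-total A 0ℤ)
  where
  E A B : ℤ
  E = + edgeCount G
  A = + (4 ℕ.* q ℕ.* edgeCount G) - (+ q - + (4 ℕ.* p)) * + n
  B = + 2 * + q * (+ k * + n)
  A≡ : A ≡ + 4 * + q * E - (+ q - + 4 * + p) * + n
  A≡ = cong₂ (λ s t → s - (+ q - t) * + n)
         (trans (pos-* (4 ℕ.* q) (edgeCount G)) (cong (_* E) (pos-* 4 q))) (pos-* 4 p)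
  A≤B : A ≤ B
  A≤B = ≤-from-gap (trans (cong (λ a → B - a) A≡) (regroup (+ p) (+ q) E (+ k) (+ n))) (gap small)
    where
    regroup : ∀ p q e k n → + 2 * q * (k * n) - (+ 4 * q * e - (q - + 4 * p) * n)
                          ≡ - (+ 4 * p * n) - q * (+ 2 * (+ 2 * e) - (+ 2 * k + 1ℤ) * n)
    regroup = solve-∀
  cube : + (4 ℕ.* q ℕ.* q ℕ.* n ℕ.^ 3) ≡ + 4 * + q * + q * (+ n * (+ n * + n))
  cube = trans (pos-* (4 ℕ.* q ℕ.* q) (n ℕ.^ 3)) (cong₂ _*_
    (trans (pos-* (4 ℕ.* q) q) (cong (_* + q) (pos-* 4 q)))
    (begin
      + (n ℕ.* (n ℕ.* (n ℕ.* 1)))     ≡⟨ cong (λ m → + (n ℕ.* (n ℕ.* m))) (ℕ.*-identityʳ n) ⟩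
      + (n ℕ.* (n ℕ.* n))             ≡⟨ pos-* n (n ℕ.* n) ⟩
      + n * + (n ℕ.* n)               ≡⟨ cong (λ m → + n * m) (pos-* n n) ⟩
      + n * (+ n * + n)               ∎))
    where open ≡-Reasoning
  by-sign : A ≤ 0ℤ ⊎ 0ℤ ≤ A → BoundHolds p q n (edgeCount G)
  by-sign (inj₁ A≤0) = inj₁ A≤0
  by-sign (inj₂ 0≤A) = inj₂ (subst (A * A ≤_) (sym cube)
    (≤-from-gap (certificate A (+ q) (+ k) (+ n))
      (gap A≤B ⊗ ((0≤+ 2 ⊗ 0≤+ q) ⊗ 0≤+ k ⊗ 0≤+ n ⊕ 0≤A)
        ⊕ 0≤+ 4 ⊗ 0≤+ q ⊗ 0≤+ q ⊗ 0≤+ n ⊗ 0≤+ n ⊗ gap k²≤n)))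
    where
    certificate : ∀ A q k n → + 4 * q * q * (n * (n * n)) - A * A
      ≡ (+ 2 * q * (k * n) - A) * (+ 2 * q * (k * n) + A) + + 4 * (q * (q * (n * (n * (n - k * k)))))
    certificate = solve-∀

-- The set `N` and its lower density.

-- N = { k² + r : 40 (r + 1) ≤ k }; next steps the pair (k , r), 0 ≤ r ≤ 2k.

next : ℕ × ℕ → ℕ × ℕ
next (k , r) = if r <ᵇ 2 ℕ.* k then (k , suc r) else (suc k , 0)

-- The integer square root of n with its remainder n - k². Recursion on n lets the counting of `N`
-- proceed by the same induction.
sqrtRem : ℕ → ℕ × ℕ
sqrtRem zero    = 0 , 0
sqrtRem (suc n) = next (sqrtRem n)

nearSquare : ℕ × ℕ → Bool
nearSquare (k , r) = 40 ℕ.* suc r ≤ᵇ k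

N : ℕ → Bool
N n = nearSquare (sqrtRem n)

data Next : ℕ × ℕ → ℕ × ℕ → Set where
  within : ∀ {k r} → r ℕ.< 2 ℕ.* k → Next (k , r) (k , suc r)
  wrap   : ∀ {k r} → r ≡ 2 ℕ.* k → Next (k , r) (suc k , 0)

-- The invariant r ≤ 2k forces r = 2k when the test fails, so that the successor is exactly (k +
-- 1)².
next-view : ∀ p → proj₂ p ℕ.≤ 2 ℕ.* proj₁ p → Next p (next p)
next-view (k , r) r≤2k with r <ᵇ 2 ℕ.* k in eq
... | true  = within (ℕ.<ᵇ⇒< r _ (subst T (sym eq) _))
... | false = wrap (ℕ.≤-antisym r≤2k (ℕ.≮⇒≥ (λ r<2k → subst T eq (ℕ.<⇒<ᵇ r<2k))))

IsSqrtRem : ℕ → ℕ × ℕ → Set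
IsSqrtRem n (k , r) = n ≡ k ℕ.* k ℕ.+ r × r ℕ.≤ 2 ℕ.* k

isSqrtRem-next : ∀ n {p q} → Next p q → IsSqrtRem n p → IsSqrtRem (suc n) q
isSqrtRem-next n {p = k , r} (within r<2k) (refl , _) = sym (ℕ.+-suc (k ℕ.* k) r) , r<2k
isSqrtRem-next n {p = k , r} (wrap refl) (refl , _) = eq k , z≤n
  where
  eq : ∀ k → suc (k ℕ.* k ℕ.+ 2 ℕ.* k) ≡ suc k ℕ.* suc k ℕ.+ 0
  eq = ℕRing.solve-∀

isSqrtRem : ∀ n → IsSqrtRem n (sqrtRem n)
isSqrtRem zero    = refl , z≤n
isSqrtRem (suc n) = isSqrtRem-next n (next-view (sqrtRem n) (proj₂ (isSqrtRem n))) (isSqrtRem n)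

countUpTo-suc : ∀ (P : ℕ → Bool) x →
                countUpTo P (suc x) ≡ countUpTo P x ℕ.+ (if P (suc x) then 1 else 0)
countUpTo-suc P x = begin
  List.sum (map ind (upTo (suc x)))
    ≡⟨ cong (λ l → List.sum (map ind l)) (upTo-∷ʳ x) ⟨
  List.sum (map ind (upTo x ∷ʳ x))
    ≡⟨ cong List.sum (map-++ ind (upTo x) (x ∷ [])) ⟩
  List.sum (map ind (upTo x) ++ (ind x ∷ []))         ≡⟨ sum-++ (map ind (upTo x)) (ind x ∷ []) ⟩
  countUpTo P x ℕ.+ (ind x ℕ.+ 0)
    ≡⟨ cong (λ s → countUpTo P x ℕ.+ s) (ℕ.+-identityʳ (ind x)) ⟩
  countUpTo P x ℕ.+ ind x                                  ∎
  where
  open ≡-Reasoning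
  ind : ℕ → ℕ
  ind m = if P (suc m) then 1 else 0

triangle : ℕ → ℕ
triangle zero    = 0
triangle (suc k) = triangle k ℕ.+ suc k

2*triangle : ∀ k → 2 ℕ.* triangle k ≡ k ℕ.* suc k
2*triangle zero    = refl
2*triangle (suc k) = begin
  2 ℕ.* (triangle k ℕ.+ suc k)             ≡⟨ ℕ.*-distribˡ-+ 2 (triangle k) (suc k) ⟩
  2 ℕ.* triangle k ℕ.+ 2 ℕ.* suc k         ≡⟨ cong (λ t → t ℕ.+ 2 ℕ.* suc k) (2*triangle k) ⟩
  k ℕ.* suc k ℕ.+ 2 ℕ.* suc k              ≡⟨ eq k ⟩
  suc k ℕ.* suc (suc k)                    ∎
  where
  open ≡-Reasoning
  eq : ∀ k → k ℕ.* suc k ℕ.+ 2 ℕ.* suc k ≡ suc k ℕ.* suc (suc k)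
  eq = ℕRing.solve-∀

-- The block [k², (k+1)²) holds ⌊k/40⌋ ≥ (k + 1)/40 − 1 elements of N; the
-- triangular numbers add up the first terms and 40 (k + 1) pays for the −1's.
Counted : ℕ → ℕ × ℕ → Set
Counted c (k , r) = triangle k ℕ.+ (40 ℕ.* (2 ℕ.+ r)) ℕ.⊓ suc k ℕ.≤ 40 ℕ.* c ℕ.+ 40 ℕ.* suc k

≤ᵇ-false : ∀ {m n} → (m ≤ᵇ n) ≡ false → n ℕ.< m
≤ᵇ-false eq = ℕ.≰⇒> (λ m≤n → subst T eq (ℕ.≤⇒≤ᵇ m≤n))

≤ᵇ-true : ∀ {m n} → (m ≤ᵇ n) ≡ true → m ℕ.≤ n
≤ᵇ-true {m} {n} eq = ℕ.≤ᵇ⇒≤ m n (subst T (sym eq) _)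

-- At r = 2k the minimum in `Counted` is k + 1, the next summand of `triangle`.
full-block : ∀ k c → Counted c (k , 2 ℕ.* k) → triangle (suc k) ℕ.≤ 40 ℕ.* c ℕ.+ 40 ℕ.* suc k
full-block k c = subst (λ m → triangle k ℕ.+ m ℕ.≤ 40 ℕ.* c ℕ.+ 40 ℕ.* suc k)
  (ℕ.m≥n⇒m⊓n≡n (begin
  suc k                        ≤⟨ ℕ.m≤m+n (suc k) _ ⟩
  suc k ℕ.+ (79 ℕ.* k ℕ.+ 79)  ≡⟨ eq k ⟩
  40 ℕ.* (2 ℕ.+ 2 ℕ.* k)       ∎))
  where
  open ℕ.≤-Reasoning
  eq : ∀ k → suc k ℕ.+ (79 ℕ.* k ℕ.+ 79) ≡ 40 ℕ.* (2 ℕ.+ 2 ℕ.* k)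
  eq = ℕRing.solve-∀

counted-next : ∀ c {p q} → Next p q → Counted c p → Counted (c ℕ.+ (if nearSquare q then 1 else 0)) q
counted-next c {k , r} (within r<2k) counted with 40 ℕ.* suc (suc r) ≤ᵇ k in eq
-- A new element of `N`: the minimum was still 40 (r + 2) and grows by at most 40, which the count
-- pays for.
... | true = begin
  triangle k ℕ.+ (40 ℕ.* (3 ℕ.+ r)) ℕ.⊓ suc k           ≤⟨ ℕ.+-monoʳ-≤ (triangle k) (ℕ.m⊓n≤m _ _) ⟩
  triangle k ℕ.+ 40 ℕ.* (3 ℕ.+ r)                       ≡⟨ eq₁ (triangle k) r ⟩
  triangle k ℕ.+ 40 ℕ.* (2 ℕ.+ r) ℕ.+ 40
    ≡⟨ cong (λ m → triangle k ℕ.+ m ℕ.+ 40) (ℕ.m≤n⇒m⊓n≡m (ℕ.m≤n⇒m≤1+n (≤ᵇ-true eq))) ⟨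
  triangle k ℕ.+ (40 ℕ.* (2 ℕ.+ r)) ℕ.⊓ suc k ℕ.+ 40    ≤⟨ ℕ.+-monoˡ-≤ 40 counted ⟩
  40 ℕ.* c ℕ.+ 40 ℕ.* suc k ℕ.+ 40                      ≡⟨ eq₂ c k ⟩
  40 ℕ.* (c ℕ.+ 1) ℕ.+ 40 ℕ.* suc k                     ∎
  where
  open ℕ.≤-Reasoning
  eq₁ : ∀ t r → t ℕ.+ 40 ℕ.* (3 ℕ.+ r) ≡ t ℕ.+ 40 ℕ.* (2 ℕ.+ r) ℕ.+ 40
  eq₁ = ℕRing.solve-∀
  eq₂ : ∀ c k → 40 ℕ.* c ℕ.+ 40 ℕ.* suc k ℕ.+ 40 ≡ 40 ℕ.* (c ℕ.+ 1) ℕ.+ 40 ℕ.* suc k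
  eq₂ = ℕRing.solve-∀
-- No new element: 40 (r + 2) > k, so the minimum had already reached k + 1 and cannot grow.
... | false = begin
  triangle k ℕ.+ (40 ℕ.* (3 ℕ.+ r)) ℕ.⊓ suc k
    ≤⟨ ℕ.+-monoʳ-≤ (triangle k) (ℕ.m⊓n≤n (40 ℕ.* (3 ℕ.+ r)) _) ⟩
  triangle k ℕ.+ suc k
    ≡⟨ cong (λ m → triangle k ℕ.+ m) (ℕ.m≥n⇒m⊓n≡n (≤ᵇ-false eq)) ⟨
  triangle k ℕ.+ (40 ℕ.* (2 ℕ.+ r)) ℕ.⊓ suc k           ≤⟨ counted ⟩
  40 ℕ.* c ℕ.+ 40 ℕ.* suc k
    ≡⟨ cong (λ m → 40 ℕ.* m ℕ.+ 40 ℕ.* suc k) (ℕ.+-identityʳ c) ⟨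
  40 ℕ.* (c ℕ.+ 0) ℕ.+ 40 ℕ.* suc k                     ∎
  where open ℕ.≤-Reasoning
counted-next c {k , r} (wrap refl) counted with 40 ≤ᵇ suc k in eq
-- The square (k + 1)² is in `N`: one 40 comes from the count and one from the increase of k,
-- together the 80 required.
... | true = begin
  triangle (suc k) ℕ.+ 80 ℕ.⊓ (2 ℕ.+ k)
    ≤⟨ ℕ.+-mono-≤ (full-block k c counted) (ℕ.m⊓n≤m 80 _) ⟩
  40 ℕ.* c ℕ.+ 40 ℕ.* suc k ℕ.+ 80                  ≡⟨ eq₁ c k ⟩
  40 ℕ.* (c ℕ.+ 1) ℕ.+ 40 ℕ.* (2 ℕ.+ k)             ∎
  where
  open ℕ.≤-Reasoning
  eq₁ : ∀ c k → 40 ℕ.* c ℕ.+ 40 ℕ.* suc k ℕ.+ 80 ≡ 40 ℕ.* (c ℕ.+ 1) ℕ.+ 40 ℕ.* (2 ℕ.+ k)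
  eq₁ = ℕRing.solve-∀
-- Here k + 2 ≤ 40, so the increase of k alone pays for the minimum.
... | false = begin
  triangle (suc k) ℕ.+ 80 ℕ.⊓ (2 ℕ.+ k)
    ≤⟨ ℕ.+-mono-≤ (full-block k c counted) (ℕ.≤-trans (ℕ.m⊓n≤n 80 _) (≤ᵇ-false eq)) ⟩
  40 ℕ.* c ℕ.+ 40 ℕ.* suc k ℕ.+ 40                  ≡⟨ eq₁ c k ⟩
  40 ℕ.* (c ℕ.+ 0) ℕ.+ 40 ℕ.* (2 ℕ.+ k)             ∎
  where
  open ℕ.≤-Reasoning
  eq₁ : ∀ c k → 40 ℕ.* c ℕ.+ 40 ℕ.* suc k ℕ.+ 40 ≡ 40 ℕ.* (c ℕ.+ 0) ℕ.+ 40 ℕ.* (2 ℕ.+ k)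
  eq₁ = ℕRing.solve-∀

counted : ∀ n → Counted (countUpTo N n) (sqrtRem n)
counted zero    = s≤s z≤n
counted (suc n) = subst (λ c → Counted c (sqrtRem (suc n))) (sym (countUpTo-suc N n))
  (counted-next (countUpTo N n) (next-view (sqrtRem n) (proj₂ (isSqrtRem n))) (counted n))

sqrt-mono : ∀ {m k r} → r ℕ.≤ 2 ℕ.* k → m ℕ.* m ℕ.≤ k ℕ.* k ℕ.+ r → m ℕ.≤ k
sqrt-mono {m} {k} {r} r≤2k m²≤n = ℕ.≮⇒≥ (λ k<m → ℕ.<-irrefl refl (begin-strict
  m ℕ.* m                  ≤⟨ m²≤n ⟩
  k ℕ.* k ℕ.+ r            ≤⟨ ℕ.+-monoʳ-≤ (k ℕ.* k) r≤2k ⟩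
  k ℕ.* k ℕ.+ 2 ℕ.* k      <⟨ ℕ.n<1+n _ ⟩
  suc (k ℕ.* k ℕ.+ 2 ℕ.* k) ≡⟨ eq k ⟩
  suc k ℕ.* suc k          ≤⟨ ℕ.*-mono-≤ k<m k<m ⟩
  m ℕ.* m                  ∎))
  where
  open ℕ.≤-Reasoning
  eq : ∀ k → suc (k ℕ.* k ℕ.+ 2 ℕ.* k) ≡ suc k ℕ.* suc k
  eq = ℕRing.solve-∀

density : PositiveLowerDensity N
-- Since x ≤ k² + 2k and 4 `triangle` k = 2k² + 2k, `Counted` gives x + k² ≤ 160 c + 160 (k + 1).
-- From k = 161 on, k² absorbs 160 (k + 1), leaving x ≤ 160 c.
density = 1 , 160 , 161 ℕ.* 161 , s≤s z≤n , s≤s z≤n ,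
  λ x M≤x → bound x (sqrtRem x) M≤x (isSqrtRem x) (counted x)
  where
  open ℕ.≤-Reasoning
  bound : ∀ x p → 161 ℕ.* 161 ℕ.≤ x → IsSqrtRem x p → Counted (countUpTo N x) p →
          1 ℕ.* x ℕ.≤ 160 ℕ.* countUpTo N x
  bound x (k , r) M≤x (refl , r≤2k) cnt = ℕ.+-cancelʳ-≤ (160 ℕ.* suc k) _ _ (begin
    1 ℕ.* (k ℕ.* k ℕ.+ r) ℕ.+ 160 ℕ.* suc k
      ≤⟨ ℕ.+-mono-≤ (ℕ.≤-trans (ℕ.≤-reflexive (ℕ.*-identityˡ (k ℕ.* k ℕ.+ r)))
                      (ℕ.+-monoʳ-≤ (k ℕ.* k) r≤2k)) 160sk≤k² ⟩
    k ℕ.* k ℕ.+ 2 ℕ.* k ℕ.+ k ℕ.* k                           ≡⟨ eq₁ k ⟩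
    2 ℕ.* (k ℕ.* suc k)                                       ≡⟨ cong (2 ℕ.*_) (2*triangle k) ⟨
    2 ℕ.* (2 ℕ.* triangle k)
      ≤⟨ ℕ.*-monoʳ-≤ 2 (ℕ.*-monoʳ-≤ 2 (ℕ.≤-trans (ℕ.m≤m+n (triangle k) _) cnt)) ⟩
    2 ℕ.* (2 ℕ.* (40 ℕ.* c ℕ.+ 40 ℕ.* suc k))                 ≡⟨ eq₂ c k ⟩
    160 ℕ.* c ℕ.+ 160 ℕ.* suc k                               ∎)
    where
    c = countUpTo N (k ℕ.* k ℕ.+ r)
    161≤k : 161 ℕ.≤ k
    161≤k = sqrt-mono {161} r≤2k M≤x
    160sk≤k² : 160 ℕ.* suc k ℕ.≤ k ℕ.* k
    160sk≤k² = begin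
      160 ℕ.* suc k         ≡⟨ ℕ.*-suc 160 k ⟩
      160 ℕ.+ 160 ℕ.* k     ≤⟨ ℕ.+-monoˡ-≤ (160 ℕ.* k) (ℕ.≤-trans (ℕ.n≤1+n 160) 161≤k) ⟩
      161 ℕ.* k             ≤⟨ ℕ.*-monoˡ-≤ k 161≤k ⟩
      k ℕ.* k               ∎
    eq₁ : ∀ k → k ℕ.* k ℕ.+ 2 ℕ.* k ℕ.+ k ℕ.* k ≡ 2 ℕ.* (k ℕ.* suc k)
    eq₁ = ℕRing.solve-∀
    eq₂ : ∀ c k → 2 ℕ.* (2 ℕ.* (40 ℕ.* c ℕ.+ 40 ℕ.* suc k)) ≡ 160 ℕ.* c ℕ.+ 160 ℕ.* suc k
    eq₂ = ℕRing.solve-∀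

-- Assembly of the theorem.

exBound : ∀ n → N n ≡ true → ExC4Bound 1 160 n
exBound n n∈N G free = bound-near-square (sqrtRem n) (proj₁ (isSqrtRem n)) (≤ᵇ-true n∈N)
  where
  bound-near-square : ∀ p → n ≡ proj₁ p ℕ.* proj₁ p ℕ.+ proj₂ p →
                      40 ℕ.* suc (proj₂ p) ℕ.≤ proj₁ p →
                      BoundHolds 1 160 n (edgeCount G)
  bound-near-square (k , r) n≡ 40[r+1]≤k = bound-from-excess 1 160 G k
    (subst (+ k * + k ≤_) (sym n≡k²+r) (≤-from-gap (cancel (+ k * + k) (+ r)) (0≤+ r)))
    (rescale (+ n) (subst (λ Y → + 40 * Y ℤ.< - + n)
      (trans (Excess.Y-deg G free (+ k) (+ r) (0≤+ k) (0≤+ r) n≡k²+r)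
             (cong (λ D → + 2 * D - (+ 2 * + k + 1ℤ) * + n) (handshake G)))
      (Excess.excess-small G free (+ k) (+ r) (0≤+ k) (0≤+ r) n≡k²+r 1≤k 0≤κ)))
    where
    -- Y = 4 E - (2k + 1) n, so Σ y < -n/40 is a saving of more than n/160 edges; hence ε = 1/160.
    rescale : ∀ n {Y} → + 40 * Y ℤ.< - n → + 160 * Y ≤ - (+ 4 * 1ℤ * n)
    rescale n {Y} 40Y<-n = ≤-from-gap (eq n Y) (0≤+ 4 ⊗ gap (<⇒≤ 40Y<-n))
      where
      eq : ∀ n Y → - (+ 4 * 1ℤ * n) - + 160 * Y ≡ + 4 * (- n - + 40 * Y)
      eq = solve-∀
    cancel : ∀ i r → i + r - i ≡ r
    cancel = solve-∀
    n≡k²+r : + n ≡ + k * + k + + r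
    n≡k²+r = trans (cong (λ m → + m) n≡)
      (trans (pos-+ (k ℕ.* k) r) (cong (λ s → s + + r) (pos-* k k)))
    1≤k : 1ℤ ≤ + k
    1≤k = +≤+ (ℕ.≤-trans (s≤s z≤n) 40[r+1]≤k)
    0≤κ : 0ℤ ≤ + k - + 40 * + r - + 40
    0≤κ = subst (0ℤ ≤_)
      (trans (cong (λ s → + k - s) (pos-* 40 (suc r))) (expand (+ k) (+ r)))
      (gap (+≤+ 40[r+1]≤k))
      where
      expand : ∀ k r → k - + 40 * (1ℤ + r) ≡ k - + 40 * r - + 40
      expand = solve-∀

theorem1p2 : ∃[ p ] ∃[ q ] (0 < p) × (0 < q) ×
    ∃[ N ] (N 0 ≡ false) × PositiveLowerDensity N ×
    (∀ n → N n ≡ true → ExC4Bound p q n)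
-- The `refl` evaluates `N` at 0, where the test reads 40 ≤ 0.
theorem1p2 = 1 , 160 , s≤s z≤n , s≤s z≤n , N , refl , density , exBound
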